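{- There exists an absolute constant $c>0$ such that for every integer $d\ge2$ and every sufficiently large $n$ (depending on $d$) there exists a $d$-regular bipartite graph $G=(A\cup B,E)$ with $|A|=|B|=n$ that is a $(k,1/2)$-multitasker for all positive integers $k\le c\log_d n$.
   Context: Graphs are finite and simple. A matching is a set of edges no two of which share a vertex. A matching $M'$ in $G$ is induced if no two distinct edges of $M'$ are joined by an edge of $G$. A bipartite graph $G=(A\cup B,E)$ with $|A|=|B|=n$ is a $(k,\alpha)$-multitasker if for every matching $M$ in $G$ of size $|M|=k$ there is a matching $M'\subseteq M$ that is induced in $G$ with $|M'|\ge\alpha|M|$. -}

module Defs where

open import Data.Bool using (Bool; T)
open import Data.Fin using (Fin)
open import Data.Fin.Subset using (∣_∣)
open import Data.Integer using (+_)
import Data.Integer as ℤ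
open import Data.List using (List; length)
open import Data.List.Membership.Propositional using (_∈_)
open import Data.List.Relation.Binary.Subset.Propositional using (_⊆_)
open import Data.List.Relation.Unary.All using (All)
open import Data.List.Relation.Unary.AllPairs using (AllPairs)
open import Data.Nat using (ℕ; _*_; _^_; _≤_)
open import Data.Product using (∃; _×_; _,_)
open import Data.Rational using (ℚ; _/_; ↥_; ↧ₙ_)
import Data.Rational as ℚ
open import Data.Sum using (_⊎_)
open import Data.Vec using (tabulate)
open import Relation.Binary.PropositionalEquality using (_≡_; _≢_)
open import Relation.Nullary using (¬_)

-- A simple bipartite graph with sides A = B = Fin n (two disjoint copies),
-- given by its biadjacency matrix: adj a b says whether a ∈ A and b ∈ B
-- are joined by an edge.
record BipartiteGraph (n : ℕ) : Set where
  field
    adj : Fin n → Fin n → Bool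

  Adj : Fin n → Fin n → Set
  Adj a b = T (adj a b)

  degreeA : Fin n → ℕ
  degreeA a = ∣ tabulate (λ b → adj a b) ∣

  degreeB : Fin n → ℕ
  degreeB b = ∣ tabulate (λ a → adj a b) ∣

  Regular : ℕ → Set
  Regular d = (∀ a → degreeA a ≡ d) × (∀ b → degreeB b ≡ d)

  -- A pair (a , b) stands for the potential edge between a ∈ A and b ∈ B.
  Pair : Set
  Pair = Fin n × Fin n

  IsEdge : Pair → Set
  IsEdge (a , b) = Adj a b

  ShareVertex : Pair → Pair → Set
  ShareVertex (a , b) (a′ , b′) = a ≡ a′ ⊎ b ≡ b′

  Joined : Pair → Pair → Set
  Joined (a , b) (a′ , b′) = Adj a b′ ⊎ Adj a′ b

  -- Sets of edges are lists.  AllPairs ranges over distinct positions and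
  -- ShareVertex is reflexive, so a matching has no repeated entries and its
  -- length is its cardinality.
  IsMatching : List Pair → Set
  IsMatching M = All IsEdge M × AllPairs (λ e f → ¬ ShareVertex e f) M

  IsInduced : List Pair → Set
  IsInduced M = ∀ {e f} → e ∈ M → f ∈ M → e ≢ f → ¬ Joined e f

  IsMultitasker : ℕ → ℚ → Set
  IsMultitasker k α =
    ∀ (M : List Pair) → IsMatching M → length M ≡ k →
    ∃ λ (M′ : List Pair) →
      IsMatching M′ × M′ ⊆ M × IsInduced M′ ×
      (α ℚ.* (+ length M / 1)) ℚ.≤ (+ length M′ / 1)

open BipartiteGraph public

-- k ≤ c · log_d n, for c = p / q > 0, d ≥ 2 and n ≥ 1: multiplying by q and
-- exponentiating to base d turns this inequality of reals into
-- d ^ (q k) ≤ n ^ p.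
_≤_·log[_]_ : ℕ → ℚ → ℕ → ℕ → Set
k ≤ c ·log[ d ] n = d ^ (↧ₙ c * k) ≤ n ^ ℤ.∣ ↥ c ∣

{-# OPTIONS --safe #-}
module Submission where

-- A graph of girth greater than 2k is a (k, ½)-multitasker: contracting the edges of a matching of
-- size k leaves a forest, and repeatedly taking a vertex of degree at most 1 while discarding its
-- neighbour yields an independent set containing half of the vertices.
--
-- High girth is obtained by switching (Erdős–Sachs).  Let G have maximum degree at most d and no
-- short cycle, and suppose a ∈ A and b ∈ B have degree less than d.  If n exceeds the size of the
-- balls around a and b, some y ∈ B is far from both.  If y is isolated, add ay; otherwise replace
-- an edge xy by ay and xb.  Either way the number of edges grows by one and no short cycle appears,
-- so the process ends with a d-regular graph.

open import Data.Bool using (Bool; true; false; T; if_then_else_)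
open import Data.Bool.Properties using (T?; T-≡; ¬-not)
open import Data.Fin using (Fin; zero; suc)
import Data.Fin.Properties as Fin
open import Data.Fin.Subset using (∣_∣)
import Data.Integer as ℤ
import Data.Integer.Properties as ℤ
open import Data.List using (List; []; _∷_; _++_; [_]; length; map; filter; concatMap; lookup)
import Data.List as List
open import Data.List.Membership.Propositional using (_∈_; _∉_; find; lose)
open import Data.List.Membership.Propositional.Properties
  using (∈-filter⁺; ∈-filter⁻; ∈-allFin; ∈-map⁺; ∈-concatMap⁺; ∈-++⁺ˡ; ∈-++⁺ʳ)
import Data.List.Properties as List
open import Data.List.Relation.Binary.Subset.Propositional using (_⊆_)
open import Data.List.Relation.Unary.All using (All; []; _∷_)
import Data.List.Relation.Unary.All as All
import Data.List.Relation.Unary.All.Properties as All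
open import Data.List.Relation.Unary.AllPairs using (AllPairs; []; _∷_)
import Data.List.Relation.Unary.AllPairs as AllPairs
import Data.List.Relation.Unary.AllPairs.Properties as AllPairs
open import Data.List.Relation.Unary.Any using (here; there; any?; index)
open import Data.List.Relation.Unary.Any.Properties using (lookup-index)
open import Data.List.Relation.Unary.Unique.Propositional using (Unique)
open import Data.Nat
  using (ℕ; zero; suc; _+_; _*_; _^_; _≤_; _<_; _≥_; z≤n; s≤s; s≤s⁻¹; _<?_; NonZero; >-nonZero)
open import Data.Nat.Properties
open import Algebra.Properties.Monoid.Sum +-0-monoid using (sum; sum-cong-≗; sum-replicate-zero)
open import Data.Nat.Tactic.RingSolver using (solve-∀)
open import Data.Product using (∃; ∃₂; _×_; _,_; proj₁; proj₂)
import Data.Product.Properties as Product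
open import Data.Rational using (ℚ; 0ℚ; ½)
import Data.Rational as ℚ
import Data.Rational.Properties as ℚ
import Data.Rational.Unnormalised as ℚᵘ
import Data.Rational.Unnormalised.Properties as ℚᵘ
open import Data.Sum using (_⊎_; inj₁; inj₂)
import Data.Sum as Sum
import Data.Sum.Properties as Sum
open import Data.Vec using (tabulate)
open import Data.Vec.Properties using (tabulate-cong)
open import Function using (_∘_; id; case_of_; Equivalence)
open import Relation.Binary.Definitions using (DecidableEquality)
open import Relation.Binary.PropositionalEquality
  using (_≡_; _≢_; refl; sym; trans; cong; cong₂; subst; module ≡-Reasoning)
open import Relation.Nullary using (¬_; Dec; yes; no; does; ¬?; contradiction)
open import Relation.Nullary.Decidable using (_⊎-dec_)

open import Defs


-- Sums and cardinalities

sum-increment : ∀ {n} {f g : Fin n → ℕ} i → g i ≡ suc (f i) →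
                (∀ j → j ≢ i → g j ≡ f j) → sum g ≡ suc (sum f)
sum-increment zero    gi≡ rest = cong₂ _+_ gi≡ (sum-cong-≗ λ j → rest (suc j) λ ())
sum-increment {f = f} (suc i) gi≡ rest = trans
  (cong₂ _+_ (rest zero λ ())
             (sum-increment i gi≡ λ j j≢i → rest (suc j) (j≢i ∘ Fin.suc-injective)))
  (+-suc (f zero) _)

sum<⇒∃< : ∀ {n d} (f : Fin n → ℕ) → sum f < n * d → ∃ λ i → f i < d
sum<⇒∃< {suc n} {d} f Σ<nd with f zero <? d
... | yes f₀<d = zero , f₀<d
... | no  f₀≮d
  with i , fi<d ← sum<⇒∃< (f ∘ suc) (+-cancelˡ-< d _ _
                     (≤-<-trans (+-monoˡ-≤ _ (≮⇒≥ f₀≮d)) Σ<nd))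
  = suc i , fi<d

sum≤ : ∀ {n d} {f : Fin n → ℕ} → (∀ i → f i ≤ d) → sum f ≤ n * d
sum≤ {zero}  f≤d = z≤n
sum≤ {suc n} f≤d = +-mono-≤ (f≤d zero) (sum≤ (f≤d ∘ suc))

sum-max⇒≡ : ∀ {n d} {f : Fin n → ℕ} → (∀ i → f i ≤ d) → sum f ≡ n * d → ∀ i → f i ≡ d
sum-max⇒≡ {suc n} {d} {f} f≤d Σ≡nd = λ where
    zero    → f₀≡d
    (suc i) → sum-max⇒≡ (f≤d ∘ suc)
                (+-cancelˡ-≡ d _ _ (trans (cong (_+ _) (sym f₀≡d)) Σ≡nd)) i
  where
  f₀≡d : f zero ≡ d
  f₀≡d = ≤-antisym (f≤d zero) (+-cancelʳ-≤ (n * d) _ _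
           (≤-trans (≤-reflexive (sym Σ≡nd)) (+-monoʳ-≤ (f zero) (sum≤ (f≤d ∘ suc)))))

indicator : Bool → ℕ
indicator b = if b then 1 else 0

∣tabulate∣≡sum : ∀ {n} (f : Fin n → Bool) → ∣ tabulate f ∣ ≡ sum (indicator ∘ f)
∣tabulate∣≡sum {zero}  f = refl
∣tabulate∣≡sum {suc n} f with f zero
... | true  = cong suc (∣tabulate∣≡sum (f ∘ suc))
... | false = ∣tabulate∣≡sum (f ∘ suc)

support : ∀ {n} → (Fin n → Bool) → List (Fin n)
support f = filter (T? ∘ f) (List.allFin _)

∈-support : ∀ {n} (f : Fin n → Bool) {i} → T (f i) → i ∈ support f
∈-support f {i} fi = ∈-filter⁺ (T? ∘ f) (∈-allFin i) fi

length-support : ∀ {n} (f : Fin n → Bool) → length (support f) ≡ ∣ tabulate f ∣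
length-support f = trans (go id) (sym (∣tabulate∣≡sum f))
  where
  go : ∀ {m} (g : Fin m → Fin _) →
       length (filter (T? ∘ f) (List.tabulate g)) ≡ sum (indicator ∘ f ∘ g)
  go {zero}  g = refl
  go {suc m} g with f (g zero)
  ... | true  = cong suc (go (g ∘ suc))
  ... | false = go (g ∘ suc)

length-concatMap : ∀ {A B : Set} (f : A → List B) {c} xs → (∀ x → length (f x) ≤ c) →
                   length (concatMap f xs) ≤ length xs * c
length-concatMap f []       f≤c = z≤n
length-concatMap f (x ∷ xs) f≤c = ≤-trans (≤-reflexive (List.length-++ (f x)))
  (+-mono-≤ (f≤c x) (length-concatMap f xs f≤c))

-- Otherwise each `g i` has a position in `xs`, and by pigeonhole two indices get the same one.
short⇒∃∉ : ∀ {n} {A : Set} → DecidableEquality A → (g : Fin n → A) →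
           (∀ {i j} → g i ≡ g j → i ≡ j) →
           ∀ xs → length xs < n → ∃ λ i → g i ∉ xs
short⇒∃∉ {n} _≟_ g g-injective xs xs<n =
  Fin.¬∀⟶∃¬ n _ (λ i → any? (g i ≟_) xs) λ g∈xs →
    let i , j , i<j , same = Fin.pigeonhole xs<n (index ∘ g∈xs)
    in Fin.<⇒≢ i<j (g-injective
         (trans (lookup-index (g∈xs i))
         (trans (cong (lookup xs) same) (sym (lookup-index (g∈xs j))))))

module _ {A : Set} (_≟_ : DecidableEquality A) where

  remove : A → List A → List A
  remove x = filter (λ y → ¬? (y ≟ x))

  remove-⊆ : ∀ x {xs} → remove x xs ⊆ xs
  remove-⊆ x = proj₁ ∘ ∈-filter⁻ (λ y → ¬? (y ≟ x))

  ∈-remove⇒≢ : ∀ {x y} xs → y ∈ remove x xs → y ≢ x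
  ∈-remove⇒≢ {x} xs = proj₂ ∘ ∈-filter⁻ (λ y → ¬? (y ≟ x)) {xs = xs}

  ∈-remove : ∀ {x y xs} → y ∈ xs → y ≢ x → y ∈ remove x xs
  ∈-remove {x} = ∈-filter⁺ (λ y → ¬? (y ≟ x))

  length-remove-< : ∀ {x xs} → x ∈ xs → length (remove x xs) < length xs
  length-remove-< {x} {xs} x∈xs = List.filter-notAll (λ y → ¬? (y ≟ x)) xs
    (lose x∈xs (λ x≢x → x≢x refl))

  -- `remove` deletes every occurrence of `x`; uniqueness limits the loss to one.
  length-remove-≥ : ∀ x {xs} → Unique xs → length xs ≤ suc (length (remove x xs))
  length-remove-≥ x {[]}     []        = z≤n
  length-remove-≥ x {y ∷ ys} (y∉ ∷ ys!) with y ≟ x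
  ... | yes refl = s≤s (≤-reflexive (cong length (sym
                     (List.filter-all (λ y → ¬? (y ≟ x)) (All.map (_∘ sym) y∉)))))
  ... | no  _    = s≤s (length-remove-≥ x ys!)

AllPairs-lookup : ∀ {A : Set} {R : A → A → Set} → (∀ {x y} → R x y → R y x) →
                  ∀ {xs x y} → AllPairs R xs → x ∈ xs → y ∈ xs → x ≢ y → R x y
AllPairs-lookup R-sym (_  ∷ _)  (here refl) (here refl) x≢x = contradiction refl x≢x
AllPairs-lookup R-sym (Rx ∷ _)  (here refl) (there y∈)  _   = All.lookup Rx y∈
AllPairs-lookup R-sym (Ry ∷ _)  (there x∈)  (here refl) _   = R-sym (All.lookup Ry x∈)
AllPairs-lookup R-sym (_  ∷ Rs) (there x∈)  (there y∈)  x≢y = AllPairs-lookup R-sym Rs x∈ y∈ x≢y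

-- Walks in bipartite graphs

Vertex Edge : ℕ → Set
Vertex n = Fin n ⊎ Fin n
Edge   n = Fin n × Fin n

-- Arbitrary relations, because walks are also taken in a graph with an edge deleted and in the
-- subgraph on the ends of some matching edges.
EdgeSet : ℕ → Set₁
EdgeSet n = Fin n → Fin n → Set

module _ {n : ℕ} where

  _≟ᵥ_ : DecidableEquality (Vertex n)
  _≟ᵥ_ = Sum.≡-dec Fin._≟_ Fin._≟_

  _≟ₑ_ : DecidableEquality (Edge n)
  _≟ₑ_ = Product.≡-dec Fin._≟_ Fin._≟_

  infixl 6 _∖_
  _∖_ : EdgeSet n → Edge n → EdgeSet n
  (E ∖ e) a b = E a b × (a , b) ≢ e

  data Step (E : EdgeSet n) : Vertex n → Vertex n → Set where
    fwd : ∀ {a b} → E a b → Step E (inj₁ a) (inj₂ b)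
    bwd : ∀ {a b} → E a b → Step E (inj₂ b) (inj₁ a)

  -- The index of a walk is only an upper bound on its length.
  infixr 5 _∷_
  data Walk (E : EdgeSet n) : ℕ → Vertex n → Vertex n → Set where
    stop : ∀ {m s} → Walk E m s s
    _∷_  : ∀ {m s t u} → Step E s t → Walk E m t u → Walk E (suc m) s u

  step-map : ∀ {E F : EdgeSet n} → (∀ {a b} → E a b → F a b) → ∀ {s t} → Step E s t → Step F s t
  step-map E⇒F (fwd e) = fwd (E⇒F e)
  step-map E⇒F (bwd e) = bwd (E⇒F e)

  walk-map : ∀ {E F : EdgeSet n} → (∀ {a b} → E a b → F a b) →
             ∀ {m s t} → Walk E m s t → Walk F m s t
  walk-map E⇒F stop    = stop
  walk-map E⇒F (x ∷ w) = step-map E⇒F x ∷ walk-map E⇒F w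

  walk-weaken : ∀ {E m m′ s t} → m ≤ m′ → Walk E m s t → Walk E m′ s t
  walk-weaken _         stop    = stop
  walk-weaken (s≤s m≤m′) (x ∷ w) = x ∷ walk-weaken m≤m′ w

  infixr 5 _++ʷ_
  _++ʷ_ : ∀ {E i j s t u} → Walk E i s t → Walk E j t u → Walk E (i + j) s u
  _++ʷ_ {i = i} {j} stop v = walk-weaken (m≤n+m j i) v
  (x ∷ w)           ++ʷ v = x ∷ (w ++ʷ v)

  step-sym : ∀ {E s t} → Step E s t → Step E t s
  step-sym (fwd e) = bwd e
  step-sym (bwd e) = fwd e

  walk-reverse : ∀ {E m s t} → Walk E m s t → Walk E m t s
  walk-reverse stop            = stop
  walk-reverse (_∷_ {m = m} x w) =
    walk-weaken (≤-reflexive (+-comm m 1)) (walk-reverse w ++ʷ step-sym x ∷ stop {m = 0})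

  -- The strict inequality reserves one of the `m` steps for the crossing from `p` to `q`.
  data Detour (E : EdgeSet n) (m : ℕ) (s t p q : Vertex n) : Set where
    detour : ∀ {i j} → i + j < m → Walk E i s p → Walk E j q t → Detour E m s t p q

  detour-extend : ∀ {E m s s′ t p q} → Step E s s′ → Detour E m s′ t p q → Detour E (suc m) s t p q
  detour-extend x (detour i+j<m w v) = detour (s≤s i+j<m) (x ∷ w) v

  -- Only the first and the last visit to the new edge matter, so one crossing suffices.
  walk-split : ∀ {E F : EdgeSet n} {a b} →
               (∀ {x y} → F x y → E x y ⊎ (x , y) ≡ (a , b)) →
               ∀ {m s t} → Walk F m s t →
               Walk E m s t ⊎ Detour E m s t (inj₁ a) (inj₂ b) ⊎ Detour E m s t (inj₂ b) (inj₁ a)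
  walk-split new stop = inj₁ stop
  walk-split new (fwd f ∷ w) with new f | walk-split new w
  ... | inj₁ e    | inj₁ v        = inj₁ (fwd e ∷ v)
  ... | inj₁ e    | inj₂ (inj₁ v) = inj₂ (inj₁ (detour-extend (fwd e) v))
  ... | inj₁ e    | inj₂ (inj₂ v) = inj₂ (inj₂ (detour-extend (fwd e) v))
  ... | inj₂ refl | inj₁ v        = inj₂ (inj₁ (detour (n<1+n _) (stop {m = 0}) v))
  ... | inj₂ refl | inj₂ (inj₁ (detour {i} {j} i+j<m _ v)) =
    inj₂ (inj₁ (detour {i = 0} (s≤s (≤-trans (m≤n+m j i) (<⇒≤ i+j<m))) stop v))
  -- The walk leaves `inj₁ a` over the new edge and later returns to it by the same edge, so the
  -- part after the return suffices.
  ... | inj₂ refl | inj₂ (inj₂ (detour {i} {j} i+j<m _ v)) =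
    inj₁ (walk-weaken (≤-trans (m≤n+m j i) (≤-trans (<⇒≤ i+j<m) (n≤1+n _))) v)
  walk-split new (bwd f ∷ w) with new f | walk-split new w
  ... | inj₁ e    | inj₁ v        = inj₁ (bwd e ∷ v)
  ... | inj₁ e    | inj₂ (inj₁ v) = inj₂ (inj₁ (detour-extend (bwd e) v))
  ... | inj₁ e    | inj₂ (inj₂ v) = inj₂ (inj₂ (detour-extend (bwd e) v))
  ... | inj₂ refl | inj₁ v        = inj₂ (inj₂ (detour (n<1+n _) (stop {m = 0}) v))
  ... | inj₂ refl | inj₂ (inj₁ (detour {i} {j} i+j<m _ v)) =
    inj₁ (walk-weaken (≤-trans (m≤n+m j i) (≤-trans (<⇒≤ i+j<m) (n≤1+n _))) v)
  ... | inj₂ refl | inj₂ (inj₂ (detour {i} {j} i+j<m _ v)) =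
    inj₂ (inj₂ (detour {i = 0} (s≤s (≤-trans (m≤n+m j i) (<⇒≤ i+j<m))) stop v))

  -- Balls and their sizes

  module _ (G : BipartiteGraph n) where

    neighbours : Vertex n → List (Vertex n)
    neighbours (inj₁ a) = map inj₂ (support (λ b → adj G a b))
    neighbours (inj₂ b) = map inj₁ (support (λ a → adj G a b))

    -- One entry per walk of length at most `r`, so vertices may repeat; the size bound counts
    -- walks.
    ball : ℕ → Vertex n → List (Vertex n)
    ball zero    s = [ s ]
    ball (suc r) s = s ∷ concatMap (ball r) (neighbours s)

    step⇒∈-neighbours : ∀ {s t} → Step (Adj G) s t → t ∈ neighbours s
    step⇒∈-neighbours (fwd e) = ∈-map⁺ inj₂ (∈-support (λ b → adj G _ b) e)
    step⇒∈-neighbours (bwd e) = ∈-map⁺ inj₁ (∈-support (λ a → adj G a _) e)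

    walk⇒∈-ball : ∀ r {s t} → Walk (Adj G) r s t → t ∈ ball r s
    walk⇒∈-ball zero    stop    = here refl
    walk⇒∈-ball (suc r) stop    = here refl
    walk⇒∈-ball (suc r) (x ∷ w) =
      there (∈-concatMap⁺ (ball r) (lose (step⇒∈-neighbours x) (walk⇒∈-ball r w)))

    module _ {d} (degA≤d : ∀ a → degreeA G a ≤ d) (degB≤d : ∀ b → degreeB G b ≤ d) where

      length-neighbours : ∀ s → length (neighbours s) ≤ d
      length-neighbours (inj₁ a) = ≤-trans
        (≤-reflexive (trans (List.length-map inj₂ (support (adj G a)))
                            (length-support (adj G a)))) (degA≤d a)
      length-neighbours (inj₂ b) = ≤-trans
        (≤-reflexive (trans (List.length-map inj₁ (support (λ a → adj G a b)))
                            (length-support (λ a → adj G a b)))) (degB≤d b)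

      -- At most `d` neighbours contribute `suc d ^ r` each, and one further such term absorbs the
      -- centre; hence the base `suc d`.
      length-ball : ∀ r s → length (ball r s) ≤ suc d ^ r
      length-ball zero    s = ≤-refl
      length-ball (suc r) s = +-mono-≤ (m^n>0 (suc d) r) (≤-trans
        (length-concatMap (ball r) (neighbours s) (length-ball r))
        (*-monoˡ-≤ (suc d ^ r) (length-neighbours s)))

-- Regular graphs of high girth by switching

module _ {n : ℕ} where

  -- Girth greater than ℓ + 1: no edge lies on a cycle of length at most ℓ + 1.
  HighGirth : BipartiteGraph n → ℕ → Set
  HighGirth G ℓ = ∀ {a b} → Adj G a b → ¬ Walk (Adj G ∖ (a , b)) ℓ (inj₁ a) (inj₂ b)

  transpose : BipartiteGraph n → BipartiteGraph n
  transpose G = record { adj = λ b a → adj G a b }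

  assign : Edge n → Bool → BipartiteGraph n → BipartiteGraph n
  assign e v G = record { adj = λ a b → if does ((a , b) ≟ₑ e) then v else adj G a b }

  -- Read from `G′` to `G` the same relation is a deletion, so one set of lemmas serves both
  -- operations.
  record Adds (G : BipartiteGraph n) (a b : Fin n) (G′ : BipartiteGraph n) : Set where
    field
      absent    : ¬ Adj G a b
      present   : Adj G′ a b
      elsewhere : ∀ x y → (x , y) ≢ (a , b) → adj G′ x y ≡ adj G x y

  open Adds

  adds-assign-true : ∀ {G a b} → ¬ Adj G a b → Adds G a b (assign (a , b) true G)
  absent    (adds-assign-true ¬ab) = ¬ab
  present   (adds-assign-true {a = a} {b} ¬ab) with (a , b) ≟ₑ (a , b)
  ... | yes _ = _
  ... | no e≢ = contradiction refl e≢
  elsewhere (adds-assign-true {a = a} {b} ¬ab) x y e≢ with (x , y) ≟ₑ (a , b)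
  ... | yes e≡ = contradiction e≡ e≢
  ... | no  _ = refl

  adds-assign-false : ∀ {G a b} → Adj G a b → Adds (assign (a , b) false G) a b G
  absent    (adds-assign-false {a = a} {b} ab) with (a , b) ≟ₑ (a , b)
  ... | yes _ = λ ()
  ... | no e≢ = contradiction refl e≢
  present   (adds-assign-false ab) = ab
  elsewhere (adds-assign-false {a = a} {b} ab) x y e≢ with (x , y) ≟ₑ (a , b)
  ... | yes e≡ = contradiction e≡ e≢
  ... | no  _ = refl

  -- Degree facts are proved for side A only; transposition carries them to side B.
  adds-transpose : ∀ {G a b G′} → Adds G a b G′ → Adds (transpose G) b a (transpose G′)
  absent    (adds-transpose add) = absent add
  present   (adds-transpose add) = present add
  elsewhere (adds-transpose add) x y e≢ = elsewhere add y x λ { refl → e≢ refl }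

  totalA totalB : BipartiteGraph n → ℕ
  totalA G = sum (degreeA G)
  totalB G = sum (degreeB G)

  indicator-increment : ∀ {x y} → T x → ¬ T y → indicator x ≡ suc (indicator y)
  indicator-increment {true} {true}  _ ¬⊤ = contradiction _ ¬⊤
  indicator-increment {true} {false} _ _  = refl

  module _ {G G′ : BipartiteGraph n} {a b : Fin n} (add : Adds G a b G′) where

    adds-new : ∀ {x y} → Adj G′ x y → Adj G x y ⊎ (x , y) ≡ (a , b)
    adds-new {x} {y} xy with (x , y) ≟ₑ (a , b)
    ... | yes e≡ = inj₂ e≡
    ... | no  e≢ = inj₁ (subst T (elsewhere add x y e≢) xy)

    adds-old : ∀ {x y} → Adj G x y → Adj G′ x y × (x , y) ≢ (a , b)
    adds-old {x} {y} xy = subst T (sym (elsewhere add x y e≢)) xy , e≢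
      where
      e≢ : (x , y) ≢ (a , b)
      e≢ refl = absent add xy

    adds-degreeA : degreeA G′ a ≡ suc (degreeA G a)
    adds-degreeA = begin
      degreeA G′ a                  ≡⟨ ∣tabulate∣≡sum (adj G′ a) ⟩
      sum (indicator ∘ adj G′ a)      ≡⟨ sum-increment b
                                         (indicator-increment (present add) (absent add))
                                         (λ y y≢b → cong indicator (elsewhere add a y (y≢b ∘ cong proj₂))) ⟩
      suc (sum (indicator ∘ adj G a)) ≡⟨ cong suc (∣tabulate∣≡sum (adj G a)) ⟨
      suc (degreeA G a)              ∎
      where open ≡-Reasoning

    adds-degreeA-≢ : ∀ x → x ≢ a → degreeA G′ x ≡ degreeA G x
    adds-degreeA-≢ x x≢a =
      cong ∣_∣ (tabulate-cong λ y → elsewhere add x y (x≢a ∘ cong proj₁))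

    adds-degreeA-≤ : ∀ x → degreeA G x ≤ degreeA G′ x
    adds-degreeA-≤ x with x Fin.≟ a
    ... | yes refl = ≤-trans (n≤1+n _) (≤-reflexive (sym adds-degreeA))
    ... | no  x≢a  = ≤-reflexive (sym (adds-degreeA-≢ x x≢a))

    adds-degreeA-bound : ∀ {d} → degreeA G a < d → (∀ x → degreeA G x ≤ d) → ∀ x → degreeA G′ x ≤ d
    adds-degreeA-bound a<d ≤d x with x Fin.≟ a
    ... | yes refl = ≤-trans (≤-reflexive adds-degreeA) a<d
    ... | no  x≢a  = ≤-trans (≤-reflexive (adds-degreeA-≢ x x≢a)) (≤d x)

    adds-totalA : totalA G′ ≡ suc (totalA G)
    adds-totalA = sum-increment a adds-degreeA adds-degreeA-≢

  -- Both totals count the edges. Keeping `balanced` as an invariant replaces a double count and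
  -- yields a deficient vertex on each side.
  record Partial (d ℓ : ℕ) (G : BipartiteGraph n) : Set where
    field
      degA≤    : ∀ a → degreeA G a ≤ d
      degB≤    : ∀ b → degreeB G b ≤ d
      balanced : totalA G ≡ totalB G
      girth    : HighGirth G ℓ

  open Partial

  -- A short cycle through an old edge `uv` either avoids `ab`, which `girth P` excludes, or uses
  -- it; then the rest of the cycle, through `uv`, is a short walk from `a` to `b`.
  partial-add : ∀ {d ℓ G a b G′} → Adds G a b G′ → Partial d ℓ G →
                degreeA G a < d → degreeB G b < d →
                ¬ Walk (Adj G) ℓ (inj₁ a) (inj₂ b) → Partial d ℓ G′
  degA≤    (partial-add add P a<d b<d far) = adds-degreeA-bound add a<d (degA≤ P)
  degB≤    (partial-add add P a<d b<d far) = adds-degreeA-bound (adds-transpose add) b<d (degB≤ P)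
  balanced (partial-add add P a<d b<d far) =
    trans (adds-totalA add) (trans (cong suc (balanced P)) (sym (adds-totalA (adds-transpose add))))
  girth    (partial-add {ℓ = ℓ} {G} {a} {b} {G′} add P a<d b<d far) {u} {v} uv w with adds-new add uv
  ... | inj₂ refl = far (walk-map old w)
    where
    old : ∀ {x y} → (Adj G′ ∖ (a , b)) x y → Adj G x y
    old (xy , e≢) = Sum.[ id , (λ e≡ → contradiction e≡ e≢) ]′ (adds-new add xy)
  ... | inj₁ uv = case walk-split new w of λ where
      (inj₁ w′)                           → girth P uv w′
      (inj₂ (inj₁ (detour i+j<ℓ w₁ w₂))) → far (shortcut i+j<ℓ (walk-reverse w₁) (fwd uv) (walk-reverse w₂))
      (inj₂ (inj₂ (detour {i} {j} i+j<ℓ w₁ w₂))) →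
        far (shortcut (subst (_< ℓ) (+-comm i j) i+j<ℓ) w₂ (bwd uv) w₁)
    where
    new : ∀ {x y} → (Adj G′ ∖ (u , v)) x y → (Adj G ∖ (u , v)) x y ⊎ (x , y) ≡ (a , b)
    new (xy , e≢) = Sum.map₁ (_, e≢) (adds-new add xy)

    -- The step that the detour spent on `ab` now pays for crossing `uv`.
    shortcut : ∀ {i j s t} → i + j < ℓ → Walk (Adj G ∖ (u , v)) i (inj₁ a) s → Step (Adj G) s t →
               Walk (Adj G ∖ (u , v)) j t (inj₂ b) → Walk (Adj G) ℓ (inj₁ a) (inj₂ b)
    shortcut {i} {j} i+j<ℓ w₁ x w₂ =
      walk-weaken (≤-trans (≤-reflexive (+-suc i j)) i+j<ℓ) (walk-map proj₁ w₁ ++ʷ x ∷ walk-map proj₁ w₂)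

  partial-delete : ∀ {d ℓ G a b G′} → Adds G a b G′ → Partial d ℓ G′ → Partial d ℓ G
  degA≤    (partial-delete add P) x = ≤-trans (adds-degreeA-≤ add x) (degA≤ P x)
  degB≤    (partial-delete add P) x = ≤-trans (adds-degreeA-≤ (adds-transpose add) x) (degB≤ P x)
  balanced (partial-delete add P) = suc-injective
    (trans (sym (adds-totalA add)) (trans (balanced P) (adds-totalA (adds-transpose add))))
  girth    (partial-delete add P) uv w =
    girth P (proj₁ (adds-old add uv)) (walk-map (λ (e , e≢) → proj₁ (adds-old add e) , e≢) w)

  -- Deleting `xy` lowers the degrees of `x` and `y` by one and the edges `xb` and `ay` restore
  -- them, so only `a` and `b` gain. The radius `2 + ℓ` leaves room to append `xy` to walks of
  -- length `ℓ` and, even for `ℓ = 0`, to go from `b` through `x` to `y`.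
  partial-swap : ∀ {d ℓ G a b x y} → Partial d ℓ G → degreeA G a < d → degreeB G b < d →
                 Adj G x y → ¬ Walk (Adj G) (2 + ℓ) (inj₁ a) (inj₂ y) →
                 ¬ Walk (Adj G) (2 + ℓ) (inj₂ b) (inj₂ y) →
                 ∃ λ G′ → Partial d ℓ G′ × totalA G′ ≡ suc (totalA G)
  partial-swap {d} {ℓ} {G} {a} {b} {x} {y} P a<d b<d xy a↛y b↛y =
    G₃ , P₃ , trans (adds-totalA add₃)
                (cong suc (trans (adds-totalA add₂) (sym (adds-totalA del))))
    where
    a≢x : a ≢ x
    a≢x refl = a↛y (fwd xy ∷ stop)
    b≢y : b ≢ y
    b≢y refl = b↛y stop

    G₁ = assign (x , y) false G
    del : Adds G₁ x y G
    del = adds-assign-false xy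
    P₁ : Partial d ℓ G₁
    P₁ = partial-delete del P
    G₁⊆G : ∀ {u v} → Adj G₁ u v → Adj G u v
    G₁⊆G = proj₁ ∘ adds-old del

    a↛₁y : ¬ Walk (Adj G₁) ℓ (inj₁ a) (inj₂ y)
    a↛₁y w = a↛y (walk-weaken (m≤n+m ℓ 2) (walk-map G₁⊆G w))

    G₂ = assign (a , y) true G₁
    add₂ : Adds G₁ a y G₂
    add₂ = adds-assign-true λ ay → a↛y (fwd (G₁⊆G ay) ∷ stop)
    P₂ : Partial d ℓ G₂
    P₂ = partial-add add₂ P₁
      (≤-<-trans (adds-degreeA-≤ del a) a<d)
      (≤-trans (≤-reflexive (sym (adds-degreeA (adds-transpose del)))) (degB≤ P y))
      a↛₁y

    -- If the walk avoids `ay`, or crosses it from `a`, then `xy` extends a reversed piece to a walk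
    -- from `b` or `a` to `y`. If it crosses from `y`, its first piece joins `x` to `y` without
    -- `xy`, closing a short cycle in `G`.
    x↛₂b : ¬ Walk (Adj G₂) ℓ (inj₁ x) (inj₂ b)
    x↛₂b w = case walk-split (adds-new add₂) w of λ where
      (inj₁ w′) → b↛y (walk-weaken (≤-trans (≤-reflexive (+-comm ℓ 1)) (n≤1+n _))
        (walk-reverse (walk-map G₁⊆G w′) ++ʷ fwd xy ∷ stop {m = 0}))
      (inj₂ (inj₁ (detour {i} {j} i+j<ℓ w₁ _))) →
        a↛y (walk-weaken
          (≤-trans (≤-reflexive (+-comm i 1)) (s≤s (≤-trans (m≤m+n i j) (m≤n⇒m≤1+n (<⇒≤ i+j<ℓ)))))
          (walk-reverse (walk-map G₁⊆G w₁) ++ʷ fwd xy ∷ stop {m = 0}))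
      (inj₂ (inj₂ (detour {i} {j} i+j<ℓ w₁ _))) →
        girth P xy (walk-weaken (≤-trans (m≤m+n i j) (<⇒≤ i+j<ℓ)) (walk-map (adds-old del) w₁))

    G₃ = assign (x , b) true G₂
    add₃ : Adds G₂ x b G₃
    add₃ = adds-assign-true λ xb → case adds-new add₂ xb of λ where
      (inj₁ xb)  → b↛y (bwd (G₁⊆G xb) ∷ fwd xy ∷ stop)
      (inj₂ refl) → a≢x refl
    P₃ : Partial d ℓ G₃
    P₃ = partial-add add₃ P₂
      (≤-trans (≤-reflexive (trans (cong suc (adds-degreeA-≢ add₂ x (a≢x ∘ sym)))
                                   (sym (adds-degreeA del)))) (degA≤ P x))
      (≤-<-trans (≤-trans (≤-reflexive (adds-degreeA-≢ (adds-transpose add₂) b b≢y))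
                          (adds-degreeA-≤ (adds-transpose del) b)) b<d)
      x↛₂b

  partial-grow : ∀ {d ℓ G} → 2 * suc d ^ (2 + ℓ) < n → Partial d ℓ G → totalA G < n * d →
                 ∃ λ G′ → Partial d ℓ G′ × totalA G′ ≡ suc (totalA G)
  partial-grow {d} {ℓ} {G} room P Σ<nd
    with a , a<d ← sum<⇒∃< (degreeA G) Σ<nd
       | b , b<d ← sum<⇒∃< (degreeB G) (subst (_< n * d) (balanced P) Σ<nd)
    with y , y∉ ← short⇒∃∉ _≟ᵥ_ inj₂ Sum.inj₂-injective
           (ball G (2 + ℓ) (inj₁ a) ++ ball G (2 + ℓ) (inj₂ b))
           (≤-<-trans (≤-trans
             (≤-reflexive (List.length-++ (ball G (2 + ℓ) (inj₁ a))))
             (+-mono-≤ (length-ball G (degA≤ P) (degB≤ P) (2 + ℓ) (inj₁ a))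
                       (≤-trans (length-ball G (degA≤ P) (degB≤ P) (2 + ℓ) (inj₂ b))
                                (≤-reflexive (sym (+-identityʳ _)))))) room)
    = extend
    where
    a↛y : ¬ Walk (Adj G) (2 + ℓ) (inj₁ a) (inj₂ y)
    a↛y w = y∉ (∈-++⁺ˡ (walk⇒∈-ball G (2 + ℓ) w))

    b↛y : ¬ Walk (Adj G) (2 + ℓ) (inj₂ b) (inj₂ y)
    b↛y w = y∉ (∈-++⁺ʳ (ball G (2 + ℓ) (inj₁ a)) (walk⇒∈-ball G (2 + ℓ) w))

    extend : ∃ λ G′ → Partial d ℓ G′ × totalA G′ ≡ suc (totalA G)
    extend with Fin.any? (λ x → T? (adj G x y))
    ... | yes (x , xy) = partial-swap P a<d b<d xy a↛y b↛y
    ... | no  isolated =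
      let add = adds-assign-true {G = G} λ ay → isolated (a , ay) in
      -- That `0 < d` follows from `a` having degree below `d`.
      _ , partial-add add P a<d (≤-<-trans (≤-reflexive degree-y) (≤-<-trans z≤n a<d))
            (a↛y ∘ walk-weaken (m≤n+m ℓ 2))
        , adds-totalA add
      where
      degree-y : degreeB G y ≡ 0
      degree-y = trans (∣tabulate∣≡sum (λ x → adj G x y))
        (trans (sum-cong-≗ λ x → cong indicator (¬-not λ xy → isolated (x , Equivalence.from T-≡ xy)))
               (sum-replicate-zero n))

  partial-empty : ∀ {d ℓ} → ∃ λ G → Partial d ℓ G × totalA G ≡ 0
  partial-empty = G , P , trans (sum-cong-≗ degA≡0) (sum-replicate-zero n)
    where
    G : BipartiteGraph n
    G = record { adj = λ _ _ → false }

    degA≡0 : ∀ a → degreeA G a ≡ 0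
    degA≡0 _ = trans (∣tabulate∣≡sum {n} (λ _ → false)) (sum-replicate-zero n)

    P : Partial _ _ G
    degA≤    P a = ≤-trans (≤-reflexive (degA≡0 a)) z≤n
    degB≤    P a = ≤-trans (≤-reflexive (degA≡0 a)) z≤n
    balanced P   = refl
    girth    P ()

  partial-exists : ∀ {d ℓ} → 2 * suc d ^ (2 + ℓ) < n → ∀ m → m ≤ n * d →
                   ∃ λ G → Partial d ℓ G × totalA G ≡ m
  partial-exists room zero    _ = partial-empty
  partial-exists room (suc m) m<nd with _ , P , refl ← partial-exists room m (<⇒≤ m<nd) =
    partial-grow room P m<nd

  -- With `n * d` edges and all degrees at most `d`, no vertex can be deficient.
  regular-highGirth : ∀ {d ℓ} → 2 * suc d ^ (2 + ℓ) < n →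
                      ∃ λ (G : BipartiteGraph n) → Regular G d × HighGirth G ℓ
  regular-highGirth room with G , P , total ← partial-exists room _ ≤-refl =
    G , ( sum-max⇒≡ (degA≤ P) total
        , sum-max⇒≡ (degB≤ P) (trans (sym (balanced P)) total))
      , girth P

-- Matchings

-- Among unnormalised rationals nothing is reduced, and the claim becomes a cross multiplication of
-- integers.
half-≤ : ∀ {k k′} → k ≤ 2 * k′ → ½ ℚ.* (ℤ.+ k ℚ./ 1) ℚ.≤ (ℤ.+ k′ ℚ./ 1)
half-≤ {k} {k′} k≤2k′ = ℚ.toℚᵘ-cancel-≤ (begin
  ℚ.toℚᵘ (½ ℚ.* (ℤ.+ k ℚ./ 1))           ≃⟨ ℚ.toℚᵘ-homo-* ½ (ℤ.+ k ℚ./ 1) ⟩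
  ℚ.toℚᵘ ½ ℚᵘ.* ℚ.toℚᵘ (ℤ.+ k ℚ./ 1)     ≃⟨ ℚᵘ.*-congˡ {ℚ.toℚᵘ ½} (ℚ.toℚᵘ-fromℚᵘ (ℚᵘ.mkℚᵘ (ℤ.+ k) 0)) ⟩
  ℚᵘ.½ ℚᵘ.* ℚᵘ.mkℚᵘ (ℤ.+ k) 0            ≤⟨ ℚᵘ.*≤* numerators ⟩
  ℚᵘ.mkℚᵘ (ℤ.+ k′) 0                     ≃⟨ ℚ.toℚᵘ-fromℚᵘ (ℚᵘ.mkℚᵘ (ℤ.+ k′) 0) ⟨
  ℚ.toℚᵘ (ℤ.+ k′ ℚ./ 1)                  ∎)
  where
  open ℚᵘ.≤-Reasoning
  lhs : (ℤ.+ 1 ℤ.* ℤ.+ k) ℤ.* ℤ.+ 1 ≡ ℤ.+ k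
  lhs = trans (ℤ.*-identityʳ (ℤ.+ 1 ℤ.* ℤ.+ k)) (ℤ.*-identityˡ (ℤ.+ k))
  rhs : ℤ.+ (2 * k′) ≡ ℤ.+ k′ ℤ.* ℤ.+ 2
  rhs = trans (ℤ.pos-* 2 k′) (ℤ.*-comm (ℤ.+ 2) (ℤ.+ k′))
  numerators : (ℤ.+ 1 ℤ.* ℤ.+ k) ℤ.* ℤ.+ 1 ℤ.≤ ℤ.+ k′ ℤ.* ℤ.+ 2
  numerators = subst (ℤ._≤ ℤ.+ k′ ℤ.* ℤ.+ 2) (sym lhs) (subst (ℤ.+ k ℤ.≤_) rhs (ℤ.+≤+ k≤2k′))

module _ {n : ℕ} (G : BipartiteGraph n) where

  share-sym : ∀ {e f} → ¬ ShareVertex G e f → ¬ ShareVertex G f e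
  share-sym ¬ef = ¬ef ∘ Sum.map sym sym

  joined-sym : ∀ {e f} → Joined G e f → Joined G f e
  joined-sym = Sum.swap

  joined? : ∀ e f → Dec (Joined G e f)
  joined? (a , b) (a′ , b′) = T? (adj G a b′) ⊎-dec T? (adj G a′ b)

  data End : Edge n → Vertex n → Set where
    left  : ∀ {a b} → End (a , b) (inj₁ a)
    right : ∀ {a b} → End (a , b) (inj₂ b)

  -- `Joined` relative to an arbitrary edge set.
  Connector : EdgeSet n → Edge n → Edge n → Set
  Connector E (a , b) (a′ , b′) = E a b′ ⊎ E a′ b

  -- The connector starts at one end of `ab`; from the other end `ab` is crossed first. Two steps
  -- thus suffice in all four cases.
  walk-across : ∀ {E a b p s} → E a b → Connector E (a , b) p → End (a , b) s →
                ∃ λ s′ → End p s′ × (∀ {m t} → Walk E m s′ t → Walk E (2 + m) s t)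
  walk-across ab (inj₁ ab′) left  = _ , right , λ w → walk-weaken (n≤1+n _) (fwd ab′ ∷ w)
  walk-across ab (inj₂ a′b) left  = _ , left  , λ w → fwd ab ∷ bwd a′b ∷ w
  walk-across ab (inj₁ ab′) right = _ , right , λ w → bwd ab ∷ fwd ab′ ∷ w
  walk-across ab (inj₂ a′b) right = _ , left  , λ w → walk-weaken (n≤1+n _) (bwd a′b ∷ w)

  -- The subgraph of `G` induced on the vertices covered by `V`. A walk in it avoids every edge with
  -- an end outside.
  Within : List (Edge n) → EdgeSet n
  Within V a b = Adj G a b × (∃ λ b′ → (a , b′) ∈ V) × (∃ λ a′ → (a′ , b) ∈ V)

  within-weaken : ∀ {e V a b} → Within V a b → Within (e ∷ V) a b
  within-weaken (ab , (b′ , a∈) , (a′ , b∈)) = ab , (b′ , there a∈) , (a′ , there b∈)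

  -- The bound allows two steps for each member of `V`.
  Connected : Edge n → List (Edge n) → Set
  Connected p V = ∀ {v s t} → v ∈ V → End p s → End v t → Walk (Within V) (2 * length V) s t

  -- Leaves in the contraction of a short matching

  module _ {ℓ M} (high : HighGirth G ℓ) (M-matching : IsMatching G M) (short : 2 * length M ≤ ℓ) where

    disjoint : ∀ {e f} → e ∈ M → f ∈ M → e ≢ f → ¬ ShareVertex G e f
    disjoint = AllPairs-lookup share-sym (proj₂ M-matching)

    edge : ∀ {e} → e ∈ M → IsEdge G e
    edge = All.lookup (proj₁ M-matching)

    -- V is the vertex set of a path in the graph on M whose adjacency is Joined, p is its last
    -- vertex, e is the next one, and R contains the remaining ones.
    record Path (e p : Edge n) (V R : List (Edge n)) : Set where
      field
        e∈M       : e ∈ M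
        V⊆M       : V ⊆ M
        R⊆M       : R ⊆ M
        e∉V       : e ∉ V
        R-fresh   : ∀ {f} → f ∈ R → f ≢ e × f ∉ V
        size      : length V + length R < length M
        cover     : ∀ {f} → f ∈ M → f ≡ e ⊎ f ∈ V ⊎ f ∈ R
        p∈V       : ∀ {v} → v ∈ V → p ∈ V
        e-p       : ∀ {v} → v ∈ V → Joined G e p
        connected : Connected p V

    open Path

    -- An empty path has no last vertex, so `e` stands in for `p`; the fields about `p` presuppose a
    -- member of `V` and hold vacuously.
    path-start : ∀ {e} → e ∈ M → Path e e [] (remove _≟ₑ_ e M)
    e∈M       (path-start e∈) = e∈
    V⊆M       (path-start e∈) ()
    R⊆M       (path-start e∈) = remove-⊆ _≟ₑ_ _
    e∉V       (path-start e∈) ()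
    R-fresh   (path-start e∈) f∈ = ∈-remove⇒≢ _≟ₑ_ M f∈ , λ ()
    size      (path-start e∈) = length-remove-< _≟ₑ_ e∈
    cover     (path-start {e} e∈) {f} f∈ with f ≟ₑ e
    ... | yes f≡e = inj₁ f≡e
    ... | no  f≢e = inj₂ (inj₂ (∈-remove _≟ₑ_ f∈ f≢e))
    p∈V       (path-start e∈) ()
    e-p       (path-start e∈) ()
    connected (path-start e∈) ()

    path-extend : ∀ {e p V R f} → Path e p V R → f ∈ R → Joined G e f → Path f e (e ∷ V) (remove _≟ₑ_ f R)
    e∈M       (path-extend P f∈ ef) = R⊆M P f∈
    V⊆M       (path-extend P f∈ ef) (here refl) = e∈M P
    V⊆M       (path-extend P f∈ ef) (there v∈)  = V⊆M P v∈
    R⊆M       (path-extend P f∈ ef) = R⊆M P ∘ remove-⊆ _≟ₑ_ _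
    e∉V       (path-extend P f∈ ef) (here refl) = proj₁ (R-fresh P f∈) refl
    e∉V       (path-extend P f∈ ef) (there f∈V) = proj₂ (R-fresh P f∈) f∈V
    R-fresh   (path-extend {R = R} P f∈ ef) g∈ = ∈-remove⇒≢ _≟ₑ_ R g∈ , λ where
      (here refl) → proj₁ (R-fresh P (remove-⊆ _≟ₑ_ _ g∈)) refl
      (there g∈V) → proj₂ (R-fresh P (remove-⊆ _≟ₑ_ _ g∈)) g∈V
    size      (path-extend {V = V} {R} P f∈ ef) =
      ≤-<-trans (≤-trans (≤-reflexive (sym (+-suc (length V) _)))
                         (+-monoʳ-≤ (length V) (length-remove-< _≟ₑ_ f∈))) (size P)
    cover     (path-extend {f = f} P f∈ ef) {g} g∈ with cover P g∈ | g ≟ₑ f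
    ... | _                | yes g≡f = inj₁ g≡f
    ... | inj₁ refl        | no _    = inj₂ (inj₁ (here refl))
    ... | inj₂ (inj₁ g∈V)  | no _    = inj₂ (inj₁ (there g∈V))
    ... | inj₂ (inj₂ g∈R)  | no g≢f  = inj₂ (inj₂ (∈-remove _≟ₑ_ g∈R g≢f))
    p∈V       (path-extend P f∈ ef) _ = here refl
    e-p       (path-extend P f∈ ef) _ = joined-sym ef
    connected (path-extend {e} {p} {V} P f∈ ef) {v} {s} {t} = go
      where
      bound : 2 + 2 * length V ≤ 2 * suc (length V)
      bound = ≤-reflexive (sym (*-suc 2 (length V)))

      connector : ∀ {e p} → p ∈ V → Joined G e p → Connector (Within (e ∷ V)) e p
      connector p∈ = Sum.map (λ ab′ → ab′ , (_ , here refl) , (_ , there p∈))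
                             (λ a′b → a′b , (_ , there p∈) , (_ , here refl))

      e-edge : Within (e ∷ V) (proj₁ e) (proj₂ e)
      e-edge = edge (e∈M P) , (_ , here refl) , (_ , here refl)

      go : v ∈ e ∷ V → End e s → End v t → Walk (Within (e ∷ V)) (2 * suc (length V)) s t
      go (here refl) left  left  = stop
      go (here refl) right right = stop
      go (here refl) left  right = fwd e-edge ∷ stop
      go (here refl) right left  = bwd e-edge ∷ stop
      go (there v∈)  s-end t-end
        with s′ , s′-end , across ← walk-across e-edge (connector (p∈V P v∈) (e-p P v∈)) s-end =
        walk-weaken bound (across (walk-map within-weaken (connected P v∈ s′-end t-end)))

    -- A second edge back into the path would close a short cycle in G.
    no-chord : ∀ {e p V R v} → Path e p V R → v ∈ V → v ≢ p → ¬ Joined G e v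
    no-chord {a , b} {p₁ , p₂} {V} {R} {a′ , b′} P v∈ v≢p = λ where
        (inj₁ ab′) →
          -- The walk goes from `a` to `p` and then inside `V` to `b′`. Its start avoids `ab′`
          -- because `v` shares no vertex with `e` or `p`, and the rest because `V` does not cover
          -- `a`.
          let s′ , s′-end , across = walk-across {E = Adj G ∖ (a , b′)}
                (edge (e∈M P) , λ { refl → e#v (inj₂ refl) })
                (Sum.map (_, λ { refl → v#p (inj₂ refl) }) (_, λ { refl → e#v (inj₂ refl) }) (e-p P v∈))
                left
              avoids : ∀ {x y} → Within V x y → (Adj G ∖ (a , b′)) x y
              avoids = λ (xy , (_ , x∈) , _) → xy , λ { refl → e#V x∈ (inj₁ refl) }
          in high ab′ (walk-weaken bound (across (walk-map avoids (connected P v∈ s′-end right))))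
        (inj₂ a′b) →
          let s′ , s′-end , across = walk-across {E = Adj G ∖ (a′ , b)}
                (edge (e∈M P) , λ { refl → e#v (inj₁ refl) })
                (Sum.map (_, λ { refl → e#v (inj₁ refl) }) (_, λ { refl → v#p (inj₁ refl) }) (e-p P v∈))
                right
              avoids : ∀ {x y} → Within V x y → (Adj G ∖ (a′ , b)) x y
              avoids = λ (xy , _ , (_ , y∈)) → xy , λ { refl → e#V y∈ (inj₂ refl) }
          in high a′b (walk-reverse
               (walk-weaken bound (across (walk-map avoids (connected P v∈ s′-end left)))))
      where
      e#V : ∀ {f} → f ∈ V → ¬ ShareVertex G (a , b) f
      e#V f∈ = disjoint (e∈M P) (V⊆M P f∈) λ { refl → e∉V P f∈ }

      e#v : ¬ ShareVertex G (a , b) (a′ , b′)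
      e#v = e#V v∈

      v#p : ¬ ShareVertex G (a′ , b′) (p₁ , p₂)
      v#p = disjoint (V⊆M P v∈) (V⊆M P (p∈V P v∈)) v≢p

      -- The two extra steps are paid for by `e`, which makes `length V` strictly less than
      -- `length M`.
      bound : 2 + 2 * length V ≤ ℓ
      bound = ≤-trans (≤-reflexive (sym (*-suc 2 (length V)))) (≤-trans
        (*-monoʳ-≤ 2 (≤-<-trans (m≤m+n (length V) (length R)) (size P))) short)

    -- Degrees zero and one in a single form: `p` is the only possible neighbour, and it may be `e`
    -- itself when there is none.
    Leaf : Set
    Leaf = ∃₂ λ e p → e ∈ M × (∀ {f} → f ∈ M → f ≢ e → f ≢ p → ¬ Joined G e f)

    -- The path is prolonged while `e` has a neighbour in `R`. Once it is maximal, `no-chord`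
    -- excludes all neighbours in `V` except `p`. The bound `m` on the length of `R` drives the
    -- recursion.
    path⇒leaf : ∀ m {e p V R} → length R ≤ m → Path e p V R → Leaf
    path⇒leaf m {e} {p} {V} {R} R≤m P with any? (joined? e) R
    ... | no  none = e , p , e∈M P , λ f∈ f≢e f≢p ef → case cover P f∈ of λ where
      (inj₁ f≡e)        → f≢e f≡e
      (inj₂ (inj₁ f∈V)) → no-chord P f∈V f≢p ef
      (inj₂ (inj₂ f∈R)) → none (lose f∈R ef)
    ... | yes some with f , f∈ , ef ← find some | ≤-trans (length-remove-< _≟ₑ_ f∈) R≤m
    path⇒leaf (suc m) R≤m P | yes some | s≤s R′≤m = path⇒leaf m R′≤m (path-extend P f∈ ef)

    leaf : ∀ {e} → e ∈ M → Leaf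
    leaf e∈ = path⇒leaf _ ≤-refl (path-start e∈)

  -- Induced halves by removing leaves

  matching⇒unique : ∀ {M} → IsMatching G M → Unique M
  matching⇒unique = AllPairs.map (λ ¬share → λ { refl → ¬share (inj₁ refl) }) ∘ proj₂

  matching-remove : ∀ e {M} → IsMatching G M → IsMatching G (remove _≟ₑ_ e M)
  matching-remove e (edges , disj) = All.filter⁺ _ edges , AllPairs.filter⁺ _ disj

  InducedHalf : List (Edge n) → Set
  InducedHalf M = ∃ λ M′ → IsMatching G M′ × M′ ⊆ M × IsInduced G M′ × length M ≤ 2 * length M′

  -- Each round keeps the leaf `e` and removes at most two members, `e` and `p`; this gives the
  -- factor one half. As `G` stays fixed, the girth hypothesis carries over.
  induced-half : ∀ {ℓ} → HighGirth G ℓ → ∀ m {M} → length M ≤ m → 2 * length M ≤ ℓ →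
                 IsMatching G M → InducedHalf M
  induced-half high m {[]} _ _ _ = [] , ([] , []) , id , (λ ()) , z≤n
  induced-half high (suc m) {M@(x ∷ _)} M≤m short matching
    with e , p , e∈ , isolated ← leaf high matching short (here {x = x} refl) = extend
    where
    M-e M-e-p : List (Edge n)
    M-e   = remove _≟ₑ_ e M
    M-e-p = remove _≟ₑ_ p M-e

    M-e<M : length M-e < length M
    M-e<M = length-remove-< _≟ₑ_ e∈

    M-e-p<M : length M-e-p < length M
    M-e-p<M = ≤-<-trans (List.length-filter _ M-e) M-e<M

    extend : InducedHalf M
    extend with M′ , (edges , disj) , M′⊆ , induced , half ← induced-half high m {M-e-p}
                  (s≤s⁻¹ (≤-trans M-e-p<M M≤m)) (≤-trans (*-monoʳ-≤ 2 (<⇒≤ M-e-p<M)) short)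
                  (matching-remove p (matching-remove e matching)) =
      e ∷ M′ , (All.lookup (proj₁ matching) e∈ ∷ edges
               , All.tabulate (λ f∈ → disjoint high matching short e∈ (M′⊆M f∈) (≢e f∈ ∘ sym)) ∷ disj)
      , (λ { (here refl) → e∈ ; (there f∈) → M′⊆M f∈ })
      , induced′
      , ≤-trans (length-remove-≥ _≟ₑ_ e unique)
          (≤-trans (s≤s (length-remove-≥ _≟ₑ_ p (matching⇒unique (matching-remove e matching))))
          (≤-trans (+-monoʳ-≤ 2 half) (≤-reflexive (sym (*-suc 2 (length M′))))))
      where
      unique : Unique M
      unique = matching⇒unique matching

      M′⊆M : M′ ⊆ M
      M′⊆M = remove-⊆ _≟ₑ_ e ∘ remove-⊆ _≟ₑ_ p ∘ M′⊆

      ≢e : ∀ {f} → f ∈ M′ → f ≢ e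
      ≢e = ∈-remove⇒≢ _≟ₑ_ M ∘ remove-⊆ _≟ₑ_ p ∘ M′⊆

      unjoined : ∀ {f} → f ∈ M′ → ¬ Joined G e f
      unjoined f∈ = isolated (M′⊆M f∈) (≢e f∈) (∈-remove⇒≢ _≟ₑ_ M-e (M′⊆ f∈))

      induced′ : IsInduced G (e ∷ M′)
      induced′ (here refl) (here refl) e≢e = contradiction refl e≢e
      induced′ (here refl) (there g∈)  _   = unjoined g∈
      induced′ (there f∈)  (here refl) _   = unjoined f∈ ∘ joined-sym
      induced′ (there f∈)  (there g∈)  f≢g = induced f∈ g∈ f≢g

  highGirth⇒multitasker : ∀ {ℓ k} → HighGirth G ℓ → 2 * k ≤ ℓ → IsMultitasker G k ½
  highGirth⇒multitasker high short M matching refl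
    with M′ , M′-matching , M′⊆M , induced , half ← induced-half high _ ≤-refl short matching =
    M′ , M′-matching , M′⊆M , induced , half-≤ {length M} {length M′} half

-- Choice of the constants

module _ {d : ℕ} (2≤d : 2 ≤ d) where

  private instance
    d-nonZero : NonZero d
    d-nonZero = >-nonZero (<⇒≤ 2≤d)

  -- `K` is the integer part of one tenth of the base `d` logarithm of `n`; raising `n` by one
  -- raises it by at most one.
  log-floor : ∀ n → 1 ≤ n → ∃ λ K → d ^ (10 * K) ≤ n × n < d ^ (10 * suc K)
  log-floor (suc zero)      _ = 0 , ≤-refl , ^-monoʳ-< d 2≤d {0} {10} (s≤s z≤n)
  log-floor (suc n@(suc _)) _ with K , lower , upper ← log-floor n (s≤s z≤n) | suc n <? d ^ (10 * suc K)
  ... | yes 1+n< = K , m≤n⇒m≤1+n lower , 1+n<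
  ... | no  1+n≮ = suc K , ≮⇒≥ 1+n≮ , ≤-<-trans upper (^-monoʳ-< d 2≤d (*-monoʳ-< 10 (n<1+n (suc K))))

  log-floor-max : ∀ {n K k} → n < d ^ (10 * suc K) → d ^ (10 * k) ≤ n → k ≤ K
  log-floor-max {n} {K} {k} upper k-lower = s≤s⁻¹ (≰⇒> λ K<k →
    <-irrefl refl (<-≤-trans upper (≤-trans (^-monoʳ-≤ d (*-monoʳ-≤ 10 K<k)) k-lower)))

  suc-≤-square : suc d ≤ d ^ 2
  suc-≤-square = begin
    1 + d   ≤⟨ +-monoˡ-≤ d (<⇒≤ 2≤d) ⟩
    d + d   ≡⟨ cong (d +_) (+-identityʳ d) ⟨
    2 * d   ≤⟨ *-monoˡ-≤ d 2≤d ⟩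
    d * d   ≡⟨ cong (d *_) (*-identityʳ d) ⟨
    d ^ 2   ∎
    where open ≤-Reasoning

  -- The source of the constant 1/10: by `2 ≤ d` and `suc d ≤ d ^ 2` the left side is at most
  -- `d ^ (5 + 4 * K)`, and `5 + 4 * K < 10 * K` once `1 ≤ K`.
  ball-bound : ∀ {K} → 1 ≤ K → 2 * suc d ^ (2 + 2 * K) < d ^ (10 * K)
  ball-bound {K} 1≤K = begin-strict
    2 * suc d ^ (2 + 2 * K)      ≤⟨ *-mono-≤ 2≤d (^-monoˡ-≤ (2 + 2 * K) suc-≤-square) ⟩
    d * (d ^ 2) ^ (2 + 2 * K)    ≡⟨ cong (d *_) (^-*-assoc d 2 (2 + 2 * K)) ⟩
    d ^ suc (2 * (2 + 2 * K))    <⟨ ^-monoʳ-< d 2≤d exponents ⟩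
    d ^ (10 * K)                 ∎
    where
    open ≤-Reasoning
    exponents : suc (2 * (2 + 2 * K)) < 10 * K
    exponents = begin
      suc (suc (2 * (2 + 2 * K)))   ≡⟨ expand K ⟩
      6 * 1 + 4 * K                  ≤⟨ +-monoˡ-≤ (4 * K) (*-monoʳ-≤ 6 1≤K) ⟩
      6 * K + 4 * K                  ≡⟨ collect K ⟩
      10 * K                         ∎
      where
      expand : ∀ K → suc (suc (2 * (2 + 2 * K))) ≡ 6 * 1 + 4 * K
      expand = solve-∀
      collect : ∀ K → 6 * K + 4 * K ≡ 10 * K
      collect = solve-∀

theorem4p5 : ∃ λ (c : ℚ) → 0ℚ ℚ.< c ×
    (∀ (d : ℕ) → d ≥ 2 →
    ∃ λ (N : ℕ) → ∀ (n : ℕ) → n ≥ N →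
    ∃ λ (G : BipartiteGraph n) →
    Regular G d ×
    (∀ (k : ℕ) → k ≥ 1 → k ≤ c ·log[ d ] n → IsMultitasker G k ½))
theorem4p5 = ℤ.+ 1 ℚ./ 10 , ℚ.*<* (ℤ.+<+ (s≤s z≤n)) , λ d 2≤d → d ^ 10 , λ n d¹⁰≤n →
  let instance d≢0 = >-nonZero (<⇒≤ 2≤d)
      K , lower , upper = log-floor 2≤d n (≤-trans (m^n>0 d 10) d¹⁰≤n)
      -- The threshold `d ^ 10` is what makes `K` positive.
      1≤K = log-floor-max 2≤d {n} {K} {1} upper d¹⁰≤n
      -- The girth is set for the largest admissible `k`, which is `K`, so one graph serves all `k`
      -- at once.
      G , regular , high = regular-highGirth {ℓ = 2 * K} (<-≤-trans (ball-bound 2≤d {K} 1≤K) lower)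
  in G , regular , λ k _ k≤ → highGirth⇒multitasker G high
       -- The numerator of 1/10 enters as `n ^ 1`, which unfolds to `n * 1`.
       (*-monoʳ-≤ 2 (log-floor-max 2≤d {n} {K} {k} upper (≤-trans k≤ (≤-reflexive (*-identityʳ n)))))
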